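{- For every even positive integer $n$ there exists a bijection $\psi\colon\{0,1\}^n\to\mathcal{B}_n$, where $\mathcal{B}_n=\{x\in\{0,1\}^{n+1}: |x|>n/2\}$, such that \[ \mathrm{maxStretch}(\psi)\le 4\qquad\text{and}\qquad \mathrm{maxStretch}(\psi^{ -1})\le 5 . \]
   Context: For a binary string $x$, $|x|$ denotes its Hamming weight (number of ones), and $\mathrm{distance}(\cdot,\cdot)$ denotes the Hamming distance. Two strings are adjacent if their Hamming distance is $1$; $x+e_i$ denotes $x$ with its $i$-th bit flipped. For $f\colon\{0,1\}^n\to\mathcal{B}_n$, \[\mathrm{maxStretch}(f)=\max_{x\in\{0,1\}^n,\ i\in[n]}\mathrm{distance}(f(x),f(x+e_i)).\] For $g\colon\mathcal{B}_n\to\{0,1\}^n$, $\mathrm{maxStretch}(g)$ is the maximum of $\mathrm{distance}(g(z),g(z'))$ over all pairs $z,z'\in\mathcal{B}_n$ with $\mathrm{distance}(z,z')=1$. -}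

module Defs where

open import Data.Bool using (Bool; true; false; not; _≟_)
open import Data.Fin using (Fin)
open import Data.Fin.Subset using (∣_∣)
open import Data.List using (List; []; _∷_; [_]; map; filter; mapMaybe; allFin;
  cartesianProduct; cartesianProductWith)
open import Data.List.Extrema.Nat using (max)
open import Data.List.Membership.Propositional using (_∈_)
open import Data.List.Membership.Propositional.Properties using (∈-cartesianProductWith⁺)
open import Data.List.Relation.Unary.Any using (here; there)
open import Data.List.Relation.Unary.Any.Properties using (mapMaybe⁺; map⁺)
import Data.List.Relation.Unary.Any as Any
open import Data.Maybe using (Maybe; just; nothing)
import Data.Maybe.Relation.Unary.Any as Maybe
open import Data.Nat using (ℕ; zero; suc; _/_; _>_; _>?_)
import Data.Nat as ℕ
open import Data.Nat.Properties using (≤-irrelevant)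
open import Data.Product using (Σ-syntax; _×_; _,_; proj₁)
open import Data.Vec as Vec using (Vec; []; _∷_; count; updateAt)
open import Relation.Binary.PropositionalEquality using (_≡_; refl; cong)
open import Relation.Nullary using (yes; no; ¬?; contradiction)

BitString : ℕ → Set
BitString = Vec Bool

distance : ∀ {n} → BitString n → BitString n → ℕ
distance x y = count (λ (a , b) → ¬? (a ≟ b)) (Vec.zip x y)

flipBit : ∀ {n} → BitString n → Fin n → BitString n
flipBit x i = updateAt x i not

-- `_/_` rounds down; this is harmless, since a natural number exceeds n/2 iff
-- it exceeds ⌊n/2⌋.
Ball : ℕ → Set
Ball n = Σ[ x ∈ BitString (suc n) ] ∣ x ∣ > n / 2

bits : List Bool
bits = false ∷ true ∷ []

allStrings : ∀ n → List (BitString n)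
allStrings zero    = [ [] ]
allStrings (suc n) = cartesianProductWith _∷_ bits (allStrings n)

toBall? : ∀ n → BitString (suc n) → Maybe (Ball n)
toBall? n x with ∣ x ∣ >? n / 2
... | yes p = just (x , p)
... | no  _ = nothing

allBall : ∀ n → List (Ball n)
allBall n = mapMaybe (toBall? n) (allStrings (suc n))

∈-bits : ∀ b → b ∈ bits
∈-bits false = here refl
∈-bits true  = there (here refl)

∈-allStrings : ∀ {n} (x : BitString n) → x ∈ allStrings n
∈-allStrings []      = here refl
∈-allStrings (b ∷ x) =
  ∈-cartesianProductWith⁺ _∷_ {xs = bits} (∈-bits b) (∈-allStrings x)

∈-allBall : ∀ {n} (z : Ball n) → z ∈ allBall n
∈-allBall {n} (x , p) =
  mapMaybe⁺ (toBall? n) (allStrings (suc n)) (map⁺ (Any.map hit (∈-allStrings x)))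
  where
  hit : ∀ {y} → x ≡ y → Maybe.Any ((x , p) ≡_) (toBall? n y)
  hit refl with ∣ x ∣ >? n / 2
  ... | yes q = Maybe.just (cong (x ,_) (≤-irrelevant p q))
  ... | no ¬p = contradiction p ¬p

-- `max 0` returns the largest element of a nonempty list of naturals, and 0 on
-- the empty list. For n ≥ 1 both maxima below range over nonempty sets.
maxStretchCube : ∀ {n} → (BitString n → Ball n) → ℕ
maxStretchCube {n} f =
  max 0 (map (λ (x , i) → distance (proj₁ (f x)) (proj₁ (f (flipBit x i))))
             (cartesianProduct (allStrings n) (allFin n)))

adjacentPairs : ∀ n → List (Ball n × Ball n)
adjacentPairs n =
  filter (λ (z , z′) → distance (proj₁ z) (proj₁ z′) ℕ.≟ 1)
         (cartesianProduct (allBall n) (allBall n))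

maxStretchBall : ∀ {n} → (Ball n → BitString n) → ℕ
maxStretchBall {n} g =
  max 0 (map (λ (z , z′) → distance (g z) (g z′)) (adjacentPairs n))

{-# OPTIONS --safe #-}

-- A string is read from left to right by a transducer with a counter t: a 1
-- increments t, a 0 decrements t, and a 0 met at t = 0 is rewritten to 1. Each
-- step is a bijection between (counter, bit) and (bit, counter), so the whole
-- run (t, x) ↦ (w, s) is reversible, the inverse being the mirror transducer,
-- which reads w from right to left starting from s. For two
-- runs in parallel, a step increases |t - t'| + (number of output mismatches)
-- only when the input bits differ, and then by at most 3; hence both directions are Lipschitz.
--
-- Let D be the number of zeros of x rewritten from t = 0 (the unmatched zeros
-- when 1s and 0s are read as parentheses). Starting from t = ⌊D/2⌋ rewrites the
-- last ⌈D/2⌉ of them; ψ x is the resulting w together with a bit recording the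
-- parity of D. The final counter is an affine function of |w| and that bit,
-- which is what makes the transducer invertible from ψ x alone.

module Submission where

open import Defs
open import Data.Bool using (Bool; true; false; not)
open import Data.Fin using (zero; suc)
open import Data.Fin.Subset using (∣_∣)
open import Data.List using (allFin; cartesianProduct)
open import Data.List.Extrema.Nat using (max≤v⁺)
import Data.List.Relation.Unary.All as All
open import Data.List.Relation.Unary.All.Properties using (map⁺; all-filter)
open import Data.Nat using (ℕ; zero; suc; pred; _+_; _*_; _∸_; _/_; _⊓_; ∣_-_∣; ⌊_/2⌋;
  _≤_; _<_; _>_; z≤n; s≤s; s≤s⁻¹)
import Data.Nat as ℕ
open import Data.Nat.Divisibility using (_∣_; divides)
open import Data.Nat.DivMod using (m*n/n≡m)
open import Data.Nat.Properties
open import Data.Nat.Tactic.RingSolver using (solve-∀)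
open import Data.Product using (Σ-syntax; ∃-syntax; _×_; _,_; proj₁)
open import Data.Product.Properties using (Σ-≡,≡→≡)
open import Data.Vec using ([]; _∷_)
open import Function.Bundles using (_↔_; mk↔ₛ′; module Inverse)
open import Relation.Binary.PropositionalEquality
open import Relation.Nullary using (contradiction; yes; no)

-- Bits, weights and Hamming distance

bit : Bool → ℕ
bit true  = 1
bit false = 0

mismatch : Bool → Bool → ℕ
mismatch a b = distance (a ∷ []) (b ∷ [])

∣∷∣ : ∀ {n} b (x : BitString n) → ∣ b ∷ x ∣ ≡ bit b + ∣ x ∣
∣∷∣ true  x = refl
∣∷∣ false x = refl

distance-∷ : ∀ {n} a b (x y : BitString n) →
  distance (a ∷ x) (b ∷ y) ≡ mismatch a b + distance x y
distance-∷ true  true  x y = refl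
distance-∷ true  false x y = refl
distance-∷ false true  x y = refl
distance-∷ false false x y = refl

distance-refl : ∀ {n} (x : BitString n) → distance x x ≡ 0
distance-refl []          = refl
distance-refl (true  ∷ x) = distance-refl x
distance-refl (false ∷ x) = distance-refl x

distance-flipBit : ∀ {n} (x : BitString n) i → distance x (flipBit x i) ≡ 1
distance-flipBit (true  ∷ x) zero    = cong suc (distance-refl x)
distance-flipBit (false ∷ x) zero    = cong suc (distance-refl x)
distance-flipBit (true  ∷ x) (suc i) = distance-flipBit x i
distance-flipBit (false ∷ x) (suc i) = distance-flipBit x i

mismatch≤1 : ∀ a b → mismatch a b ≤ 1
mismatch≤1 true  true  = z≤n
mismatch≤1 true  false = ≤-refl
mismatch≤1 false true  = ≤-refl
mismatch≤1 false false = z≤n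

∣bit-bit∣≡mismatch : ∀ a b → ∣ bit a - bit b ∣ ≡ mismatch a b
∣bit-bit∣≡mismatch true  true  = refl
∣bit-bit∣≡mismatch true  false = refl
∣bit-bit∣≡mismatch false true  = refl
∣bit-bit∣≡mismatch false false = refl

∣+-+∣≤∣-∣+∣-∣ : ∀ a b c d → ∣ a + b - c + d ∣ ≤ ∣ a - c ∣ + ∣ b - d ∣
∣+-+∣≤∣-∣+∣-∣ a b c d = begin
  ∣ a + b - c + d ∣                     ≤⟨ ∣-∣-triangle (a + b) (c + b) (c + d) ⟩
  ∣ a + b - c + b ∣ + ∣ c + b - c + d ∣ ≡⟨ cong₂ _+_ ∣a+b-c+b∣ (∣m+n-m+o∣≡∣n-o∣ c b d) ⟩
  ∣ a - c ∣ + ∣ b - d ∣                 ∎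
  where
  open ≤-Reasoning
  ∣a+b-c+b∣ : ∣ a + b - c + b ∣ ≡ ∣ a - c ∣
  ∣a+b-c+b∣ = trans (cong₂ ∣_-_∣ (+-comm a b) (+-comm c b)) (∣m+n-m+o∣≡∣n-o∣ b a c)

∣∣-lipschitz : ∀ {n} (x y : BitString n) → ∣ ∣ x ∣ - ∣ y ∣ ∣ ≤ distance x y
∣∣-lipschitz []      []      = z≤n
∣∣-lipschitz (a ∷ x) (b ∷ y) = begin
  ∣ ∣ a ∷ x ∣ - ∣ b ∷ y ∣ ∣                ≡⟨ cong₂ ∣_-_∣ (∣∷∣ a x) (∣∷∣ b y) ⟩
  ∣ bit a + ∣ x ∣ - bit b + ∣ y ∣ ∣        ≤⟨ ∣+-+∣≤∣-∣+∣-∣ (bit a) (∣ x ∣) (bit b) (∣ y ∣) ⟩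
  ∣ bit a - bit b ∣ + ∣ ∣ x ∣ - ∣ y ∣ ∣    ≤⟨ +-mono-≤ (≤-reflexive (∣bit-bit∣≡mismatch a b)) (∣∣-lipschitz x y) ⟩
  mismatch a b + distance x y              ≡⟨ distance-∷ a b x y ⟨
  distance (a ∷ x) (b ∷ y)                 ∎
  where open ≤-Reasoning

-- A position where both strings have a 1 adds 2 to the sum of weights, a disagreement adds 1; `k`
-- counts the common ones. Only the resulting congruence modulo 2 matters later.
distance-parity : ∀ {n} (x y : BitString n) →
  ∃[ k ] ∣ x ∣ + ∣ y ∣ ≡ distance x y + 2 * k
distance-parity []      []      = 0 , refl
distance-parity (a ∷ x) (b ∷ y) with distance-parity x y
distance-parity (true  ∷ x) (true  ∷ y) | k , eq = suc k , (begin
  suc (∣ x ∣) + suc (∣ y ∣)    ≡⟨ +-suc (suc (∣ x ∣)) (∣ y ∣) ⟩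
  2 + (∣ x ∣ + ∣ y ∣)          ≡⟨ cong (2 +_) eq ⟩
  2 + (distance x y + 2 * k)   ≡⟨ rearrange (distance x y) k ⟩
  distance x y + 2 * suc k     ∎)
  where
  open ≡-Reasoning
  rearrange : ∀ d k → 2 + (d + 2 * k) ≡ d + 2 * suc k
  rearrange = solve-∀
distance-parity (true  ∷ x) (false ∷ y) | k , eq = k , cong suc eq
distance-parity (false ∷ x) (true  ∷ y) | k , eq = k , trans (+-suc (∣ x ∣) (∣ y ∣)) (cong suc eq)
distance-parity (false ∷ x) (false ∷ y) | k , eq = k , eq

-- The transducer

emit : Bool → ℕ → Bool
emit true  t       = true
emit false zero    = true
emit false (suc t) = false

move : Bool → ℕ → ℕ
move true  t = suc t
move false t = pred t

-- Reading a 1 leaves a positive counter, so an output 1 with new counter 0 can only come from a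
-- rewritten 0.
emit⁻¹ : Bool → ℕ → Bool
emit⁻¹ false s       = false
emit⁻¹ true  zero    = false
emit⁻¹ true  (suc s) = true

move⁻¹ : Bool → ℕ → ℕ
move⁻¹ false s = suc s
move⁻¹ true  s = pred s

encode : ∀ {n} → ℕ → BitString n → BitString n
encode t []      = []
encode t (b ∷ x) = emit b t ∷ encode (move b t) x

encodeState : ∀ {n} → ℕ → BitString n → ℕ
encodeState t []      = t
encodeState t (b ∷ x) = encodeState (move b t) x

-- The tail is processed before the head, so `s` enters at the right end and the result is the
-- counter at the left end.
decodeState : ∀ {n} → ℕ → BitString n → ℕ
decodeState s []      = s
decodeState s (b ∷ w) = move⁻¹ b (decodeState s w)

decode : ∀ {n} → ℕ → BitString n → BitString n
decode s []      = []
decode s (b ∷ w) = emit⁻¹ b (decodeState s w) ∷ decode s w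

move⁻¹-move : ∀ b t → move⁻¹ (emit b t) (move b t) ≡ t
move⁻¹-move true  t       = refl
move⁻¹-move false zero    = refl
move⁻¹-move false (suc t) = refl

emit⁻¹-emit : ∀ b t → emit⁻¹ (emit b t) (move b t) ≡ b
emit⁻¹-emit true  t       = refl
emit⁻¹-emit false zero    = refl
emit⁻¹-emit false (suc t) = refl

move-move⁻¹ : ∀ b s → move (emit⁻¹ b s) (move⁻¹ b s) ≡ s
move-move⁻¹ false s       = refl
move-move⁻¹ true  zero    = refl
move-move⁻¹ true  (suc s) = refl

emit-emit⁻¹ : ∀ b s → emit (emit⁻¹ b s) (move⁻¹ b s) ≡ b
emit-emit⁻¹ false s       = refl
emit-emit⁻¹ true  zero    = refl
emit-emit⁻¹ true  (suc s) = refl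

decodeState-encode : ∀ {n} t (x : BitString n) →
  decodeState (encodeState t x) (encode t x) ≡ t
decodeState-encode t []      = refl
decodeState-encode t (b ∷ x) = trans
  (cong (move⁻¹ (emit b t)) (decodeState-encode (move b t) x))
  (move⁻¹-move b t)

decode-encode : ∀ {n} t (x : BitString n) →
  decode (encodeState t x) (encode t x) ≡ x
decode-encode t []      = refl
decode-encode t (b ∷ x) = cong₂ _∷_
  (trans (cong (emit⁻¹ (emit b t)) (decodeState-encode (move b t) x)) (emit⁻¹-emit b t))
  (decode-encode (move b t) x)

encodeState-decode : ∀ {n} s (w : BitString n) →
  encodeState (decodeState s w) (decode s w) ≡ s
encodeState-decode s []      = refl
encodeState-decode s (b ∷ w) = trans
  (cong (λ t → encodeState t (decode s w)) (move-move⁻¹ b (decodeState s w)))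
  (encodeState-decode s w)

encode-decode : ∀ {n} s (w : BitString n) →
  encode (decodeState s w) (decode s w) ≡ w
encode-decode s []      = refl
encode-decode s (b ∷ w) = cong₂ _∷_
  (emit-emit⁻¹ b (decodeState s w))
  (trans
    (cong (λ t → encode t (decode s w)) (move-move⁻¹ b (decodeState s w)))
    (encode-decode s w))

-- Stretch of the transducer

∣1+m-n∣≤1+∣m-n∣ : ∀ m n → ∣ suc m - n ∣ ≤ suc ∣ m - n ∣
∣1+m-n∣≤1+∣m-n∣ m       zero    = s≤s (≤-reflexive (sym (∣-∣-identityʳ m)))
∣1+m-n∣≤1+∣m-n∣ zero    (suc n) = m≤n⇒m≤1+n (n≤1+n n)
∣1+m-n∣≤1+∣m-n∣ (suc m) (suc n) = ∣1+m-n∣≤1+∣m-n∣ m n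

∣m-n∣≤1+∣m-1+n∣ : ∀ m n → ∣ m - n ∣ ≤ suc ∣ m - suc n ∣
∣m-n∣≤1+∣m-1+n∣ zero    n       = m≤n⇒m≤1+n (n≤1+n n)
∣m-n∣≤1+∣m-1+n∣ (suc m) zero    = s≤s (≤-reflexive (sym (∣-∣-identityʳ m)))
∣m-n∣≤1+∣m-1+n∣ (suc m) (suc n) = ∣m-n∣≤1+∣m-1+n∣ m n

∣1+m-n∣≤2+∣m-1+n∣ : ∀ m n → ∣ suc m - n ∣ ≤ 2 + ∣ m - suc n ∣
∣1+m-n∣≤2+∣m-1+n∣ m n = ≤-trans (∣1+m-n∣≤1+∣m-n∣ m n) (s≤s (∣m-n∣≤1+∣m-1+n∣ m n))

-- The 3 is made up of 2, because the counters move in opposite directions, and 1 for a possible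
-- output mismatch.
step-lipschitz-true-false : ∀ t t′ →
  mismatch true (emit false t′) + ∣ suc t - pred t′ ∣ ≤ ∣ t - t′ ∣ + 3
step-lipschitz-true-false t zero = begin
  suc t                ≤⟨ m≤n+m (suc t) 2 ⟩
  3 + t                ≡⟨ +-comm 3 t ⟩
  t + 3                ≡⟨ cong (_+ 3) (∣-∣-identityʳ t) ⟨
  ∣ t - 0 ∣ + 3        ∎
  where open ≤-Reasoning
step-lipschitz-true-false t (suc t′) = begin
  1 + ∣ suc t - t′ ∣       ≤⟨ s≤s (∣1+m-n∣≤2+∣m-1+n∣ t t′) ⟩
  3 + ∣ t - suc t′ ∣       ≡⟨ +-comm 3 _ ⟩
  ∣ t - suc t′ ∣ + 3       ∎
  where open ≤-Reasoning

-- On equal input bits the outputs differ only if both bits are 0 and exactly one counter is 0. Then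
-- only the other counter drops, and the gap shrinks by 1, which pays for the mismatch.
step-lipschitz : ∀ b b′ t t′ →
  mismatch (emit b t) (emit b′ t′) + ∣ move b t - move b′ t′ ∣ ≤
  ∣ t - t′ ∣ + 3 * mismatch b b′
step-lipschitz true  true  t       t′       = m≤m+n _ _
step-lipschitz false false zero    zero     = z≤n
step-lipschitz false false zero    (suc t′) = m≤m+n _ _
step-lipschitz false false (suc t) zero     =
  s≤s (≤-trans (≤-reflexive (∣-∣-identityʳ t)) (m≤m+n t 0))
step-lipschitz false false (suc t) (suc t′) = m≤m+n _ _
step-lipschitz true  false t       t′       = step-lipschitz-true-false t t′
step-lipschitz false true  t       t′       = begin
  mismatch (emit false t) true + ∣ pred t - suc t′ ∣
    ≡⟨ cong₂ _+_ (mismatch-comm (emit false t) true) (∣-∣-comm (pred t) (suc t′)) ⟩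
  mismatch true (emit false t) + ∣ suc t′ - pred t ∣
    ≤⟨ step-lipschitz-true-false t′ t ⟩
  ∣ t′ - t ∣ + 3
    ≡⟨ cong (_+ 3) (∣-∣-comm t′ t) ⟩
  ∣ t - t′ ∣ + 3 ∎
  where
  open ≤-Reasoning
  mismatch-comm : ∀ a b → mismatch a b ≡ mismatch b a
  mismatch-comm true  true  = refl
  mismatch-comm true  false = refl
  mismatch-comm false true  = refl
  mismatch-comm false false = refl

-- The mirror step is the forward step with the bits complemented.
step⁻¹-lipschitz : ∀ b b′ s s′ →
  mismatch (emit⁻¹ b s) (emit⁻¹ b′ s′) + ∣ move⁻¹ b s - move⁻¹ b′ s′ ∣ ≤
  ∣ s - s′ ∣ + 3 * mismatch b b′
step⁻¹-lipschitz b b′ s s′ = subst₂ _≤_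
  (cong₂ _+_
    (trans (cong₂ mismatch (emit-not b s) (emit-not b′ s′)) (mismatch-not (emit⁻¹ b s) (emit⁻¹ b′ s′)))
    (cong₂ ∣_-_∣ (move-not b s) (move-not b′ s′)))
  (cong (λ d → ∣ s - s′ ∣ + 3 * d) (mismatch-not b b′))
  (step-lipschitz (not b) (not b′) s s′)
  where
  mismatch-not : ∀ a b → mismatch (not a) (not b) ≡ mismatch a b
  mismatch-not true  true  = refl
  mismatch-not true  false = refl
  mismatch-not false true  = refl
  mismatch-not false false = refl
  emit-not : ∀ b s → emit (not b) s ≡ not (emit⁻¹ b s)
  emit-not true  zero    = refl
  emit-not true  (suc s) = refl
  emit-not false s       = refl
  move-not : ∀ b s → move (not b) s ≡ move⁻¹ b s
  move-not true  s = refl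
  move-not false s = refl

encode-lipschitz : ∀ {n} t t′ (x y : BitString n) →
  distance (encode t x) (encode t′ y) ≤ ∣ t - t′ ∣ + 3 * distance x y
encode-lipschitz t t′ []      []      = z≤n
encode-lipschitz t t′ (a ∷ x) (b ∷ y) = begin
  distance (encode t (a ∷ x)) (encode t′ (b ∷ y))
    ≡⟨ distance-∷ (emit a t) (emit b t′) (encode (move a t) x) (encode (move b t′) y) ⟩
  m + distance (encode (move a t) x) (encode (move b t′) y)
    ≤⟨ +-monoʳ-≤ m (encode-lipschitz (move a t) (move b t′) x y) ⟩
  m + (∣ move a t - move b t′ ∣ + 3 * distance x y)
    ≡⟨ +-assoc m _ _ ⟨
  m + ∣ move a t - move b t′ ∣ + 3 * distance x y
    ≤⟨ +-monoˡ-≤ _ (step-lipschitz a b t t′) ⟩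
  ∣ t - t′ ∣ + 3 * mismatch a b + 3 * distance x y
    ≡⟨ rearrange (∣ t - t′ ∣) (mismatch a b) (distance x y) ⟩
  ∣ t - t′ ∣ + 3 * (mismatch a b + distance x y)
    ≡⟨ cong (λ d → ∣ t - t′ ∣ + 3 * d) (distance-∷ a b x y) ⟨
  ∣ t - t′ ∣ + 3 * distance (a ∷ x) (b ∷ y) ∎
  where
  open ≤-Reasoning
  m = mismatch (emit a t) (emit b t′)
  rearrange : ∀ p q r → p + 3 * q + 3 * r ≡ p + 3 * (q + r)
  rearrange = solve-∀

-- The gap between the resulting counters has to stay on the left: the head is decoded from the
-- counters that the tails produce, so the induction step spends that gap.
decode-lipschitz : ∀ {n} s s′ (w v : BitString n) →
  distance (decode s w) (decode s′ v) + ∣ decodeState s w - decodeState s′ v ∣ ≤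
  ∣ s - s′ ∣ + 3 * distance w v
decode-lipschitz s s′ []      []      = m≤m+n _ _
decode-lipschitz s s′ (a ∷ w) (b ∷ v) = begin
  distance (decode s (a ∷ w)) (decode s′ (b ∷ v)) + p
    ≡⟨ cong (_+ p) (distance-∷ (emit⁻¹ a K) (emit⁻¹ b K′) (decode s w) (decode s′ v)) ⟩
  m + d + p
    ≡⟨ rearrange₁ m d p ⟩
  d + (m + p)
    ≤⟨ +-monoʳ-≤ d (step⁻¹-lipschitz a b K K′) ⟩
  d + (∣ K - K′ ∣ + 3 * mismatch a b)
    ≡⟨ +-assoc d _ _ ⟨
  d + ∣ K - K′ ∣ + 3 * mismatch a b
    ≤⟨ +-monoˡ-≤ _ (decode-lipschitz s s′ w v) ⟩
  ∣ s - s′ ∣ + 3 * distance w v + 3 * mismatch a b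
    ≡⟨ rearrange₂ (∣ s - s′ ∣) (distance w v) (mismatch a b) ⟩
  ∣ s - s′ ∣ + 3 * (mismatch a b + distance w v)
    ≡⟨ cong (λ e → ∣ s - s′ ∣ + 3 * e) (distance-∷ a b w v) ⟨
  ∣ s - s′ ∣ + 3 * distance (a ∷ w) (b ∷ v) ∎
  where
  open ≤-Reasoning
  K  = decodeState s w
  K′ = decodeState s′ v
  m  = mismatch (emit⁻¹ a K) (emit⁻¹ b K′)
  d  = distance (decode s w) (decode s′ v)
  p  = ∣ move⁻¹ a K - move⁻¹ b K′ ∣
  rearrange₁ : ∀ m d p → m + d + p ≡ d + (m + p)
  rearrange₁ = solve-∀
  rearrange₂ : ∀ p q r → p + 3 * q + 3 * r ≡ p + 3 * (r + q)
  rearrange₂ = solve-∀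

-- The number of unmatched zeros

-- Prefixing a 0 adds an unmatched zero, and prefixing a 1 matches the first unmatched zero if there
-- is one. This is the recursion of `move⁻¹`, here applied to an input string instead of an output.
deficit : ∀ {n} → BitString n → ℕ
deficit = decodeState 0

-- The constant 2, sharper than the 3 of `step⁻¹-lipschitz`, is what lets half the deficit change by
-- at most 1 under a flip.
move⁻¹-lipschitz : ∀ b b′ s s′ →
  ∣ move⁻¹ b s - move⁻¹ b′ s′ ∣ ≤ ∣ s - s′ ∣ + 2 * mismatch b b′
move⁻¹-lipschitz true  true  zero    zero     = z≤n
move⁻¹-lipschitz true  true  zero    (suc s′) = ≤-trans (n≤1+n s′) (m≤m+n _ _)
move⁻¹-lipschitz true  true  (suc s) zero     =
  ≤-trans (≤-reflexive (∣-∣-identityʳ s)) (≤-trans (n≤1+n s) (m≤m+n _ _))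
move⁻¹-lipschitz true  true  (suc s) (suc s′) = m≤m+n _ _
move⁻¹-lipschitz false false s       s′       = m≤m+n _ _
move⁻¹-lipschitz true  false zero    s′       = ≤-trans (n≤1+n _) (≤-reflexive (+-comm 2 s′))
move⁻¹-lipschitz true  false (suc s) s′       =
  ≤-trans (∣m-1+n∣≤2+∣1+m-n∣ s s′) (≤-reflexive (+-comm 2 _))
  where
  ∣m-1+n∣≤2+∣1+m-n∣ : ∀ m n → ∣ m - suc n ∣ ≤ 2 + ∣ suc m - n ∣
  ∣m-1+n∣≤2+∣1+m-n∣ m n = subst₂ (λ p q → p ≤ 2 + q)
    (∣-∣-comm (suc n) m) (∣-∣-comm n (suc m)) (∣1+m-n∣≤2+∣m-1+n∣ n m)
move⁻¹-lipschitz false true  s       zero     = begin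
  suc s             ≤⟨ n≤1+n _ ⟩
  2 + s             ≡⟨ +-comm 2 s ⟩
  s + 2             ≡⟨ cong (_+ 2) (∣-∣-identityʳ s) ⟨
  ∣ s - 0 ∣ + 2     ∎
  where open ≤-Reasoning
move⁻¹-lipschitz false true  s       (suc s′) =
  ≤-trans (∣1+m-n∣≤2+∣m-1+n∣ s s′) (≤-reflexive (+-comm 2 _))

deficit-lipschitz : ∀ {n} (x y : BitString n) →
  ∣ deficit x - deficit y ∣ ≤ 2 * distance x y
deficit-lipschitz []      []      = z≤n
deficit-lipschitz (a ∷ x) (b ∷ y) = begin
  ∣ deficit (a ∷ x) - deficit (b ∷ y) ∣
    ≤⟨ move⁻¹-lipschitz a b (deficit x) (deficit y) ⟩
  ∣ deficit x - deficit y ∣ + 2 * mismatch a b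
    ≤⟨ +-monoˡ-≤ _ (deficit-lipschitz x y) ⟩
  2 * distance x y + 2 * mismatch a b
    ≡⟨ rearrange (distance x y) (mismatch a b) ⟩
  2 * (mismatch a b + distance x y)
    ≡⟨ cong (2 *_) (distance-∷ a b x y) ⟨
  2 * distance (a ∷ x) (b ∷ y) ∎
  where
  open ≤-Reasoning
  rearrange : ∀ q r → 2 * q + 2 * r ≡ 2 * (r + q)
  rearrange = solve-∀

-- Weights

-- The starting counter absorbs the first `t` unmatched zeros; each remaining one becomes a 1.
∣encode∣ : ∀ {n} t (x : BitString n) → ∣ encode t x ∣ ≡ ∣ x ∣ + (deficit x ∸ t)
∣encode∣ t       []          = sym (0∸n≡0 t)
∣encode∣ t       (true  ∷ x) = cong suc (trans (∣encode∣ (suc t) x)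
  (cong (∣ x ∣ +_) (sym (∸-+-assoc (deficit x) 1 t))))
∣encode∣ zero    (false ∷ x) = trans (cong suc (∣encode∣ zero x)) (sym (+-suc _ _))
∣encode∣ (suc t) (false ∷ x) = ∣encode∣ t x

-- In every step the change of the counter plus 1 equals input bit plus output bit; this is summed
-- over the run.
encodeState-weight : ∀ {n} t (x : BitString n) →
  encodeState t x + n ≡ t + ∣ x ∣ + ∣ encode t x ∣
encodeState-weight t []      = sym (+-identityʳ _)
encodeState-weight {suc n} t (b ∷ x) = begin
  encodeState (move b t) x + suc n                    ≡⟨ +-suc _ n ⟩
  suc (encodeState (move b t) x + n)                  ≡⟨ cong suc (encodeState-weight (move b t) x) ⟩
  suc (move b t + ∣ x ∣ + ∣ encode (move b t) x ∣)    ≡⟨ step b t (∣ x ∣) _ ⟩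
  t + (bit b + ∣ x ∣) + (bit (emit b t) + ∣ encode (move b t) x ∣)
    ≡⟨ cong₂ (λ p q → t + p + q) (∣∷∣ b x) (∣∷∣ (emit b t) (encode (move b t) x)) ⟨
  t + ∣ b ∷ x ∣ + ∣ encode t (b ∷ x) ∣                ∎
  where
  open ≡-Reasoning
  rearrange : ∀ t p q → suc (suc t + p + q) ≡ t + suc p + suc q
  rearrange = solve-∀
  step : ∀ b t p q → suc (move b t + p + q) ≡ t + (bit b + p) + (bit (emit b t) + q)
  step true  t       = rearrange t
  step false zero    = λ p q → sym (+-suc p q)
  step false (suc t) = λ p q → refl

-- Halving the deficit

isEven : ℕ → Bool
isEven zero          = true
isEven (suc zero)    = false
isEven (suc (suc m)) = isEven m

halves : ∀ m → m ≡ bit (not (isEven m)) + ⌊ m /2⌋ + ⌊ m /2⌋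
halves zero          = refl
halves (suc zero)    = refl
halves (suc (suc m)) = trans (cong (2 +_) (halves m)) (rearrange (bit (not (isEven m))) ⌊ m /2⌋)
  where
  rearrange : ∀ p c → 2 + (p + c + c) ≡ p + suc c + suc c
  rearrange = solve-∀

⌊b+c+c/2⌋≡c : ∀ b c → ⌊ bit b + c + c /2⌋ ≡ c
⌊b+c+c/2⌋≡c true  zero    = refl
⌊b+c+c/2⌋≡c false zero    = refl
⌊b+c+c/2⌋≡c true  (suc c) = cong suc (trans (cong ⌊_/2⌋ (+-suc c c)) (⌊b+c+c/2⌋≡c true c))
⌊b+c+c/2⌋≡c false (suc c) = trans (cong ⌊_/2⌋ (cong suc (+-suc c c))) (cong suc (⌊b+c+c/2⌋≡c false c))

isEven[b+c+c]≡not-b : ∀ b c → isEven (bit b + c + c) ≡ not b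
isEven[b+c+c]≡not-b true  zero    = refl
isEven[b+c+c]≡not-b false zero    = refl
isEven[b+c+c]≡not-b true  (suc c) = trans (cong isEven (+-suc c c)) (isEven[b+c+c]≡not-b true c)
isEven[b+c+c]≡not-b false (suc c) = trans (cong isEven (cong suc (+-suc c c))) (isEven[b+c+c]≡not-b false c)

⌊/2⌋-lipschitz : ∀ m m′ → ∣ m - m′ ∣ ≤ 2 → ∣ ⌊ m /2⌋ - ⌊ m′ /2⌋ ∣ ≤ 1
⌊/2⌋-lipschitz zero          m′              p = ⌊n/2⌋-mono p
⌊/2⌋-lipschitz (suc zero)    zero            p = z≤n
⌊/2⌋-lipschitz (suc zero)    (suc zero)      p = z≤n
⌊/2⌋-lipschitz (suc zero)    (suc (suc m′))  p = s≤s (⌊n/2⌋-mono (s≤s⁻¹ p))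
⌊/2⌋-lipschitz (suc (suc m)) zero            p = ⌊n/2⌋-mono p
⌊/2⌋-lipschitz (suc (suc m)) (suc zero)      p = s≤s (⌊n/2⌋-mono (s≤s⁻¹ p))
⌊/2⌋-lipschitz (suc (suc m)) (suc (suc m′))  p = ⌊/2⌋-lipschitz m m′ p

bit-not : ∀ b → bit (not b) + bit b ≡ 1
bit-not true  = refl
bit-not false = refl

-- The map, its inverse, and the two round trips

keep : ∀ {n} → BitString n → ℕ
keep x = ⌊ deficit x /2⌋

-- With 1 for even deficits, this bit plus the number of rewritten zeros is `suc (keep x)` for
-- either parity.
parityBit : ∀ {n} → BitString n → Bool
parityBit x = isEven (deficit x)

image : ∀ {n} → BitString n → BitString (suc n)
image x = parityBit x ∷ encode (keep x) x

-- The first argument of `decode` is the final counter of the forward run, as computed by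
-- `final-state`.
preimage : ∀ {n} → BitString (suc n) → BitString n
preimage {n} (b ∷ w) = decode (∣ w ∣ + ∣ b ∷ w ∣ ∸ suc n) w

∣image∣ : ∀ {n} (x : BitString n) → ∣ image x ∣ ≡ suc (∣ x ∣ + keep x)
∣image∣ x = begin
  ∣ image x ∣                         ≡⟨ ∣∷∣ e (encode c x) ⟩
  bit e + ∣ encode c x ∣              ≡⟨ cong (bit e +_) (∣encode∣ c x) ⟩
  bit e + (∣ x ∣ + (deficit x ∸ c))   ≡⟨ cong (λ r → bit e + (∣ x ∣ + r)) D∸c ⟩
  bit e + (∣ x ∣ + (bit (not e) + c)) ≡⟨ rearrange (bit e) (bit (not e)) (∣ x ∣) c ⟩
  bit (not e) + bit e + (∣ x ∣ + c)   ≡⟨ cong (_+ (∣ x ∣ + c)) (bit-not e) ⟩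
  suc (∣ x ∣ + c)                     ∎
  where
  open ≡-Reasoning
  c = keep x
  e = parityBit x
  D∸c : deficit x ∸ c ≡ bit (not e) + c
  D∸c = trans (cong (_∸ c) (halves (deficit x))) (m+n∸n≡m (bit (not e) + c) c)
  rearrange : ∀ p q r s → p + (r + (q + s)) ≡ q + p + (r + s)
  rearrange = solve-∀

final-state : ∀ {n} (x : BitString n) →
  ∣ encode (keep x) x ∣ + ∣ image x ∣ ≡ encodeState (keep x) x + suc n
final-state {n} x = begin
  ∣ w ∣ + ∣ image x ∣          ≡⟨ cong (∣ w ∣ +_) (∣image∣ x) ⟩
  ∣ w ∣ + suc (∣ x ∣ + c)      ≡⟨ rearrange (∣ w ∣) (∣ x ∣) c ⟩
  suc (c + ∣ x ∣ + ∣ w ∣)      ≡⟨ cong suc (encodeState-weight c x) ⟨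
  suc (encodeState c x + n)    ≡⟨ +-suc _ n ⟨
  encodeState c x + suc n      ∎
  where
  open ≡-Reasoning
  c = keep x
  w = encode c x
  rearrange : ∀ p q r → p + suc (q + r) ≡ suc (r + q + p)
  rearrange = solve-∀

preimage-image : ∀ {n} (x : BitString n) → preimage (image x) ≡ x
preimage-image {n} x = trans
  (cong (λ s → decode s (encode (keep x) x))
    (trans (cong (_∸ suc n) (final-state x)) (m+n∸n≡m (encodeState (keep x) x) (suc n))))
  (decode-encode (keep x) x)

-- Since `c ≤ d` and `d` equals `m ∸ c`, which is at most `m`, the subtraction is not truncated.
m∸c≡d⇒m≡d+c : ∀ {m} c d → c ≤ d → m ∸ c ≡ d → m ≡ d + c
m∸c≡d⇒m≡d+c {m} c d c≤d eq with c ≤? m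
... | yes c≤m = trans (sym (m∸n+n≡m c≤m)) (cong (_+ c) eq)
... | no  c≰m = contradiction (≤-trans c≤d (≤-trans (≤-reflexive (sym eq)) (m∸n≤m m c))) c≰m

-- Decoding yields a string `x` and a starting counter `c` that encode to `w`. It remains to see
-- that `c` is the counter that `image` picks for `x`, and that `b` is the right parity; both follow
-- from `D≡`.
image-preimage : ∀ {n} b (w : BitString n) → suc n ≤ ∣ w ∣ + ∣ b ∷ w ∣ →
  image (preimage (b ∷ w)) ≡ b ∷ w
image-preimage {n} b w n<2∣w∣+b = cong₂ _∷_ parity≡b (trans (cong (λ t → encode t x) keep≡c) w≡)
  where
  s = ∣ w ∣ + ∣ b ∷ w ∣ ∸ suc n
  x = decode s w
  c = decodeState s w
  D = deficit x

  w≡ : encode c x ≡ w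
  w≡ = encode-decode s w

  ∣w∣≡ : ∣ w ∣ ≡ ∣ x ∣ + (D ∸ c)
  ∣w∣≡ = trans (cong ∣_∣ (sym w≡)) (∣encode∣ c x)

  -- The sum of `∣ w ∣` and `∣ b ∷ w ∣` is evaluated twice: through the number of rewritten zeros,
  -- and through the final counter `s`.
  balance : ∣ w ∣ + ∣ x ∣ + (bit b + (D ∸ c)) ≡ ∣ w ∣ + ∣ x ∣ + suc c
  balance = begin
    ∣ w ∣ + ∣ x ∣ + (bit b + (D ∸ c))   ≡⟨ rearrange₁ (∣ w ∣) (∣ x ∣) (bit b) (D ∸ c) ⟩
    ∣ w ∣ + (bit b + (∣ x ∣ + (D ∸ c))) ≡⟨ cong (λ r → ∣ w ∣ + (bit b + r)) ∣w∣≡ ⟨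
    ∣ w ∣ + (bit b + ∣ w ∣)             ≡⟨ cong (∣ w ∣ +_) (∣∷∣ b w) ⟨
    ∣ w ∣ + ∣ b ∷ w ∣                   ≡⟨ m∸n+n≡m n<2∣w∣+b ⟨
    s + suc n                           ≡⟨ +-suc s n ⟩
    suc (s + n)                         ≡⟨ cong (λ r → suc (r + n)) (encodeState-decode s w) ⟨
    suc (encodeState c x + n)           ≡⟨ cong suc (encodeState-weight c x) ⟩
    suc (c + ∣ x ∣ + ∣ encode c x ∣)    ≡⟨ cong (λ v → suc (c + ∣ x ∣ + ∣ v ∣)) w≡ ⟩
    suc (c + ∣ x ∣ + ∣ w ∣)             ≡⟨ rearrange₂ c (∣ x ∣) (∣ w ∣) ⟩
    ∣ w ∣ + ∣ x ∣ + suc c               ∎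
    where
    open ≡-Reasoning
    rearrange₁ : ∀ p q r s → p + q + (r + s) ≡ p + (r + (q + s))
    rearrange₁ = solve-∀
    rearrange₂ : ∀ p q r → suc (p + q + r) ≡ r + q + suc p
    rearrange₂ = solve-∀

  D∸c : D ∸ c ≡ bit (not b) + c
  D∸c = +-cancelˡ-≡ (bit b) _ _ (begin
    bit b + (D ∸ c)             ≡⟨ +-cancelˡ-≡ (∣ w ∣ + ∣ x ∣) _ _ balance ⟩
    suc c                       ≡⟨ cong (_+ c) (bit-not b) ⟨
    bit (not b) + bit b + c     ≡⟨ rearrange (bit (not b)) (bit b) c ⟩
    bit b + (bit (not b) + c)   ∎)
    where
    open ≡-Reasoning
    rearrange : ∀ p q r → p + q + r ≡ q + (p + r)
    rearrange = solve-∀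

  D≡ : D ≡ bit (not b) + c + c
  D≡ = m∸c≡d⇒m≡d+c c (bit (not b) + c) (m≤n+m c (bit (not b))) D∸c

  keep≡c : keep x ≡ c
  keep≡c = trans (cong ⌊_/2⌋ D≡) (⌊b+c+c/2⌋≡c (not b) c)

  not-not : ∀ a → not (not a) ≡ a
  not-not true  = refl
  not-not false = refl

  parity≡b : parityBit x ≡ b
  parity≡b = trans (cong isEven D≡) (trans (isEven[b+c+c]≡not-b (not b) c) (not-not b))

-- Stretch of the map

m+n≡∣m-n∣+2m⊓n : ∀ m n → m + n ≡ ∣ m - n ∣ + 2 * (m ⊓ n)
m+n≡∣m-n∣+2m⊓n zero    n       = sym (+-identityʳ n)
m+n≡∣m-n∣+2m⊓n (suc m) zero    = refl
m+n≡∣m-n∣+2m⊓n (suc m) (suc n) = begin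
  suc m + suc n                      ≡⟨ +-suc (suc m) n ⟩
  2 + (m + n)                        ≡⟨ cong (2 +_) (m+n≡∣m-n∣+2m⊓n m n) ⟩
  2 + (∣ m - n ∣ + 2 * (m ⊓ n))      ≡⟨ rearrange (∣ m - n ∣) (m ⊓ n) ⟩
  ∣ m - n ∣ + 2 * suc (m ⊓ n)        ∎
  where
  open ≡-Reasoning
  rearrange : ∀ p q → 2 + (p + 2 * q) ≡ p + 2 * suc q
  rearrange = solve-∀

-- By `∣image∣`, the image weights sum to `∣ x ∣ + ∣ y ∣` plus `keep x + keep y` plus 2. The first
-- two sums are odd, so the total is even, and with it the distance of the images.
image-distance≢5 : ∀ {n} (x y : BitString n) → distance x y ≡ 1 →
  ∣ keep x - keep y ∣ ≡ 1 → distance (image x) (image y) ≢ 5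
image-distance≢5 x y d≡1 k≡1 d≡5
  with j , ∣x∣+∣y∣ ← distance-parity x y
     | k , ∣image∣+∣image∣ ← distance-parity (image x) (image y)
  = even≢odd (2 + j + (c ⊓ c′)) (2 + k) (begin
  2 * (2 + j + (c ⊓ c′))
    ≡⟨ rearrange₁ j (c ⊓ c′) ⟩
  2 + ((1 + 2 * j) + (1 + 2 * (c ⊓ c′)))
    ≡⟨ cong₂ (λ p q → 2 + ((p + 2 * j) + (q + 2 * (c ⊓ c′)))) d≡1 k≡1 ⟨
  2 + ((distance x y + 2 * j) + (∣ c - c′ ∣ + 2 * (c ⊓ c′)))
    ≡⟨ cong₂ (λ p q → 2 + (p + q)) ∣x∣+∣y∣ (m+n≡∣m-n∣+2m⊓n c c′) ⟨
  2 + ((∣ x ∣ + ∣ y ∣) + (c + c′))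
    ≡⟨ rearrange₂ (∣ x ∣) (∣ y ∣) c c′ ⟩
  suc (∣ x ∣ + c) + suc (∣ y ∣ + c′)
    ≡⟨ cong₂ _+_ (∣image∣ x) (∣image∣ y) ⟨
  ∣ image x ∣ + ∣ image y ∣
    ≡⟨ ∣image∣+∣image∣ ⟩
  distance (image x) (image y) + 2 * k
    ≡⟨ cong (_+ 2 * k) d≡5 ⟩
  5 + 2 * k
    ≡⟨ rearrange₃ k ⟩
  suc (2 * (2 + k)) ∎)
  where
  open ≡-Reasoning
  c  = keep x
  c′ = keep y
  rearrange₁ : ∀ p q → 2 * (2 + p + q) ≡ 2 + ((1 + 2 * p) + (1 + 2 * q))
  rearrange₁ = solve-∀
  rearrange₂ : ∀ p q r s → 2 + ((p + q) + (r + s)) ≡ suc (p + r) + suc (q + s)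
  rearrange₂ = solve-∀
  rearrange₃ : ∀ p → 5 + 2 * p ≡ suc (2 * (2 + p))
  rearrange₃ = solve-∀

-- The 4 is 1 for the parity bit and 3 for the flipped input bit.
image-lipschitz : ∀ {n} (x y : BitString n) → distance x y ≡ 1 →
  distance (image x) (image y) ≤ 4 + ∣ keep x - keep y ∣
image-lipschitz x y d≡1 = begin
  distance (image x) (image y)
    ≡⟨ distance-∷ (parityBit x) (parityBit y) (encode (keep x) x) (encode (keep y) y) ⟩
  mismatch (parityBit x) (parityBit y) + distance (encode (keep x) x) (encode (keep y) y)
    ≤⟨ +-mono-≤ (mismatch≤1 (parityBit x) (parityBit y)) (encode-lipschitz (keep x) (keep y) x y) ⟩
  1 + (∣ keep x - keep y ∣ + 3 * distance x y)
    ≡⟨ cong (λ d → 1 + (∣ keep x - keep y ∣ + 3 * d)) d≡1 ⟩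
  1 + (∣ keep x - keep y ∣ + 3)
    ≡⟨ cong suc (+-comm _ 3) ⟩
  4 + ∣ keep x - keep y ∣ ∎
  where open ≤-Reasoning

keep-close : ∀ {n} (x y : BitString n) → distance x y ≡ 1 → ∣ keep x - keep y ∣ ≤ 1
keep-close x y d≡1 = ⌊/2⌋-lipschitz (deficit x) (deficit y)
  (subst (λ d → ∣ deficit x - deficit y ∣ ≤ 2 * d) d≡1 (deficit-lipschitz x y))

-- The Lipschitz estimates alone give 5 when keep changes by 1; the parity of
-- the distance then improves this to 4.
image-stretch : ∀ {n} (x y : BitString n) → distance x y ≡ 1 →
  distance (image x) (image y) ≤ 4
image-stretch x y d≡1 with ∣ keep x - keep y ∣ ℕ.≟ 1
... | no  k≢1 = subst (λ k → distance (image x) (image y) ≤ 4 + k)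
  (n<1⇒n≡0 (≤∧≢⇒< (keep-close x y d≡1) k≢1)) (image-lipschitz x y d≡1)
... | yes k≡1 = s≤s⁻¹ (≤∧≢⇒<
  (subst (λ k → distance (image x) (image y) ≤ 4 + k) k≡1 (image-lipschitz x y d≡1))
  (image-distance≢5 x y d≡1 k≡1))

-- Stretch of the inverse

preimage-lipschitz : ∀ {n} a b (w v : BitString n) →
  suc n ≤ ∣ w ∣ + ∣ a ∷ w ∣ → suc n ≤ ∣ v ∣ + ∣ b ∷ v ∣ →
  distance (preimage (a ∷ w)) (preimage (b ∷ v)) ≤ 5 * distance (a ∷ w) (b ∷ v)
preimage-lipschitz {n} a b w v p q = begin
  distance (decode s w) (decode s′ v)
    ≤⟨ m≤m+n _ _ ⟩
  distance (decode s w) (decode s′ v) + ∣ decodeState s w - decodeState s′ v ∣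
    ≤⟨ decode-lipschitz s s′ w v ⟩
  ∣ s - s′ ∣ + 3 * d
    -- A flip inside `w` is counted in both weights, so it moves the final counter by up to 2 on top
    -- of the 3 for decoding. A flip of the parity bit costs only 1.
    ≤⟨ +-monoˡ-≤ (3 * d) s-close ⟩
  d + (m + d) + 3 * d
    -- The cost of the parity bit is rounded up from 1 to 5 to give one common factor.
    ≤⟨ m≤m+n _ (4 * m) ⟩
  d + (m + d) + 3 * d + 4 * m
    ≡⟨ rearrange d m ⟩
  5 * (m + d)
    ≡⟨ cong (5 *_) (distance-∷ a b w v) ⟨
  5 * distance (a ∷ w) (b ∷ v) ∎
  where
  open ≤-Reasoning
  s  = ∣ w ∣ + ∣ a ∷ w ∣ ∸ suc n
  s′ = ∣ v ∣ + ∣ b ∷ v ∣ ∸ suc n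
  d  = distance w v
  m  = mismatch a b
  rearrange : ∀ d m → d + (m + d) + 3 * d + 4 * m ≡ 5 * (m + d)
  rearrange = solve-∀
  s-close : ∣ s - s′ ∣ ≤ d + (m + d)
  s-close = begin
    ∣ s - s′ ∣
      ≡⟨ ∣m+n-m+o∣≡∣n-o∣ (suc n) s s′ ⟨
    ∣ suc n + s - suc n + s′ ∣
      ≡⟨ cong₂ ∣_-_∣ (m+[n∸m]≡n p) (m+[n∸m]≡n q) ⟩
    ∣ ∣ w ∣ + ∣ a ∷ w ∣ - ∣ v ∣ + ∣ b ∷ v ∣ ∣
      ≤⟨ ∣+-+∣≤∣-∣+∣-∣ (∣ w ∣) (∣ a ∷ w ∣) (∣ v ∣) (∣ b ∷ v ∣) ⟩
    ∣ ∣ w ∣ - ∣ v ∣ ∣ + ∣ ∣ a ∷ w ∣ - ∣ b ∷ v ∣ ∣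
      ≤⟨ +-mono-≤ (∣∣-lipschitz w v) (∣∣-lipschitz (a ∷ w) (b ∷ v)) ⟩
    d + distance (a ∷ w) (b ∷ v)
      ≡⟨ cong (d +_) (distance-∷ a b w v) ⟩
    d + (m + d) ∎

-- Membership in the ball

half-even : ∀ {n} ((divides h _) : 2 ∣ n) → n / 2 ≡ h
half-even (divides h refl) = m*n/n≡m h 2

-- For even n, membership in the ball says exactly that the subtraction in
-- preimage is not truncated.
Ball⇒slack : ∀ {n} → 2 ∣ n → ∀ b (w : BitString n) →
  ∣ b ∷ w ∣ > n / 2 → suc n ≤ ∣ w ∣ + ∣ b ∷ w ∣
Ball⇒slack {n} 2∣n@(divides h n≡h*2) b w p = begin
  suc n                ≡⟨ cong suc (trans n≡h*2 (*-comm h 2)) ⟩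
  suc (h + (h + 0))    ≡⟨ cong (λ k → suc (h + k)) (+-identityʳ h) ⟩
  suc (h + h)          ≡⟨ +-suc h h ⟨
  h + suc h            ≤⟨ +-mono-≤ (s≤s⁻¹ (≤-trans h<∣z∣ ∣z∣≤1+∣w∣)) h<∣z∣ ⟩
  ∣ w ∣ + ∣ b ∷ w ∣    ∎
  where
  open ≤-Reasoning
  h<∣z∣ : h < ∣ b ∷ w ∣
  h<∣z∣ = subst (_< ∣ b ∷ w ∣) (half-even 2∣n) p
  ∣z∣≤1+∣w∣ : ∣ b ∷ w ∣ ≤ suc (∣ w ∣)
  ∣z∣≤1+∣w∣ = ≤-trans (≤-reflexive (∣∷∣ b w)) (+-monoˡ-≤ (∣ w ∣) (bit≤1 b))
    where
    bit≤1 : ∀ b → bit b ≤ 1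
    bit≤1 true  = ≤-refl
    bit≤1 false = z≤n

slack⇒Ball : ∀ {n} → 2 ∣ n → ∀ b (w : BitString n) →
  suc n ≤ ∣ w ∣ + ∣ b ∷ w ∣ → ∣ b ∷ w ∣ > n / 2
slack⇒Ball {n} 2∣n@(divides h n≡h*2) b w p =
  subst (_< ∣ b ∷ w ∣) (sym (half-even 2∣n)) (*-cancelˡ-< 2 h (∣ b ∷ w ∣) (begin-strict
  2 * h                          ≡⟨ trans (*-comm 2 h) (sym n≡h*2) ⟩
  n                              <⟨ p ⟩
  ∣ w ∣ + ∣ b ∷ w ∣              ≤⟨ +-monoˡ-≤ _ (≤-trans (m≤n+m (∣ w ∣) (bit b)) (≤-reflexive (sym (∣∷∣ b w)))) ⟩
  ∣ b ∷ w ∣ + ∣ b ∷ w ∣          ≡⟨ cong (∣ b ∷ w ∣ +_) (+-identityʳ _) ⟨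
  2 * ∣ b ∷ w ∣                  ∎))
  where open ≤-Reasoning

-- The bijection and both stretch bounds

theorem1 : (n : ℕ) → n > 0 → 2 ∣ n →
    Σ[ ψ ∈ (BitString n ↔ Ball n) ]
    (maxStretchCube (Inverse.to ψ) ≤ 4 × maxStretchBall (Inverse.from ψ) ≤ 5)
theorem1 n _ 2∣n = mk↔ₛ′ ψ ψ⁻¹ ψ-ψ⁻¹ preimage-image , cube-bound , ball-bound
  where
  ψ : BitString n → Ball n
  -- By `final-state` the two weights sum to the final counter plus `suc n`, hence to at least
  -- `suc n`.
  ψ x = image x , slack⇒Ball 2∣n (parityBit x) (encode (keep x) x)
    (≤-trans (m≤n+m (suc n) _) (≤-reflexive (sym (final-state x))))

  ψ⁻¹ : Ball n → BitString n
  ψ⁻¹ (z , _) = preimage z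

  ψ-ψ⁻¹ : ∀ z → ψ (ψ⁻¹ z) ≡ z
  ψ-ψ⁻¹ (b ∷ w , p) = Σ-≡,≡→≡
    (image-preimage b w (Ball⇒slack 2∣n b w p) , ≤-irrelevant _ _)

  cube-bound : maxStretchCube ψ ≤ 4
  -- `z≤n` covers the initial value 0 of `max`.
  cube-bound = max≤v⁺ z≤n (map⁺ (All.universal
    (λ (x , i) → image-stretch x (flipBit x i) (distance-flipBit x i))
    (cartesianProduct (allStrings n) (allFin n))))

  ball-bound : maxStretchBall ψ⁻¹ ≤ 5
  ball-bound = max≤v⁺ z≤n (map⁺ (All.map
    (λ { {(a ∷ w , p) , (b ∷ v , q)} d≡1 →
      subst (λ d → distance (preimage (a ∷ w)) (preimage (b ∷ v)) ≤ 5 * d) d≡1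
        (preimage-lipschitz a b w v (Ball⇒slack 2∣n a w p) (Ball⇒slack 2∣n b v q)) })
    (all-filter (λ (z , z′) → distance (proj₁ z) (proj₁ z′) ℕ.≟ 1)
      (cartesianProduct (allBall n) (allBall n)))))
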